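{- Let $G$ be a digraph and $n\ge 1$. If $G$ is congruence $n$-permutable then $G^{\bot\top}$ is congruence $(n+2)$-permutable. If $G$ is nondismantlable and $G^{\bot\top}$ is congruence $(n+2)$-permutable, then $G$ is congruence $n$-permutable.
   Context: Digraphs are finite and loopless. For $G=(V,E)$: $G^\bot$ is the digraph on $V\cup\{\bot\}$ with edges $E\cup\{(\bot,v):v\in V\}$; $G^\top$ is the digraph on $V\cup\{\top\}$ with edges $E\cup\{(v,\top):v\in V\}$; $G^{\bot\top}=(G^\bot)^\top$. For a vertex $x$, $x^+=\{v:(x,v)\in E\}$ and $x^-=\{v:(v,x)\in E\}$. $G$ is nondismantlable if for all $v,w\in V$, $v^+\subseteq w^+$ and $v^-\subseteq w^-$ imply $v=w$. A polymorphism is a map $f:V^k\to V$ with $(f(a_1,\dots,a_k),f(b_1,\dots,b_k))\in E$ whenever all $(a_i,b_i)\in E$. A digraph is congruence $n$-permutable if it has ternary polymorphisms $p_0,\dots,p_n$ with $p_0(x,y,z)=x$, $p_i(x,x,y)=p_{i+1}(x,y,y)$ for $0\le i<n$, and $p_n(x,y,z)=z$, for all vertices $x,y,z$; congruence $1$-permutable means the equation $x=y$ holds, i.e. the digraph has one vertex. -}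

module Defs where

open import Data.Fin using (Fin; zero; suc; inject₁; fromℕ)
open import Data.Maybe using (Maybe; just; nothing)
open import Data.Nat using (ℕ; suc)
open import Data.Vec using (Vec; []; _∷_)
open import Data.Vec.Relation.Binary.Pointwise.Inductive using (Pointwise)
open import Function using (_↔_; mk↔ₛ′; Inverse)
open import Level using (0ℓ)
open import Relation.Binary using (Rel; Decidable; Irreflexive)
open import Relation.Binary.PropositionalEquality using (_≡_; refl; cong)
open import Relation.Nullary.Construct.Add.Infimum using (_₋)
open import Relation.Nullary.Construct.Add.Supremum using (_⁺)
open import Relation.Unary using (Pred; _⊆_)
import Relation.Binary.Construct.Add.Infimum.Strict as AddInfimum
import Relation.Binary.Construct.Add.Supremum.Strict as AddSupremum

record Digraph : Set₁ where
  infix 4 _⟶_ _⟶?_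
  field
    V        : Set
    order    : ℕ
    finite   : V ↔ Fin order
    _⟶_      : Rel V 0ℓ
    _⟶?_     : Decidable _⟶_
    loopless : Irreflexive _≡_ _⟶_

  outNbrs : V → Pred V 0ℓ
  outNbrs x v = x ⟶ v

  inNbrs : V → Pred V 0ℓ
  inNbrs x v = v ⟶ x

open Digraph using (V)

-- _₋ and _⁺ are both Maybe.
Maybe↔Fin : ∀ {A : Set} {n} → A ↔ Fin n → Maybe A ↔ Fin (suc n)
Maybe↔Fin {A} {n} A↔Fin = mk↔ₛ′ f g f∘g g∘f
  where
  open Inverse A↔Fin

  f : Maybe A → Fin (suc n)
  f nothing  = zero
  f (just a) = suc (to a)

  g : Fin (suc n) → Maybe A
  g zero    = nothing
  g (suc i) = just (from i)

  f∘g : ∀ i → f (g i) ≡ i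
  f∘g zero    = refl
  f∘g (suc i) = cong suc (strictlyInverseˡ i)

  g∘f : ∀ a → g (f a) ≡ a
  g∘f nothing  = refl
  g∘f (just a) = cong just (strictlyInverseʳ a)

-- The edges of AddInfimum._<₋_ are exactly E ∪ {(⊥, v) : v ∈ V}: there is no
-- edge into ⊥, in particular no loop at ⊥.  Dually for AddSupremum._<⁺_.
infixl 30 _^⊥ _^⊤ _^⊥⊤

_^⊥ : Digraph → Digraph
G ^⊥ = record
  { V        = V G ₋
  ; finite   = Maybe↔Fin finite
  ; _⟶_      = AddInfimum._<₋_ _⟶_
  ; _⟶?_     = AddInfimum.<₋-dec _⟶_ _⟶?_
  ; loopless = AddInfimum.<₋-irrefl-≡ _⟶_ loopless
  }
  where open Digraph G using (finite; _⟶_; _⟶?_; loopless)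

_^⊤ : Digraph → Digraph
G ^⊤ = record
  { V        = V G ⁺
  ; finite   = Maybe↔Fin finite
  ; _⟶_      = AddSupremum._<⁺_ _⟶_
  ; _⟶?_     = AddSupremum.<⁺-dec _⟶_ _⟶?_
  ; loopless = AddSupremum.<⁺-irrefl-≡ _⟶_ loopless
  }
  where open Digraph G using (finite; _⟶_; _⟶?_; loopless)

_^⊥⊤ : Digraph → Digraph
G ^⊥⊤ = (G ^⊥) ^⊤

Nondismantlable : Digraph → Set
Nondismantlable G =
  ∀ v w → outNbrs v ⊆ outNbrs w → inNbrs v ⊆ inNbrs w → v ≡ w
  where open Digraph G using (outNbrs; inNbrs)

IsPolymorphism : (G : Digraph) (k : ℕ) → (Vec (V G) k → V G) → Set
IsPolymorphism G k f = ∀ {as bs} → Pointwise _⟶_ as bs → f as ⟶ f bs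
  where open Digraph G using (_⟶_)

-- For n = 1 the identities give x ≡ p₀(x,x,y) ≡ p₁(x,y,y) ≡ y, so they hold
-- iff any two vertices are equal; no separate clause is needed.
record CongruencePermutable (n : ℕ) (G : Digraph) : Set where
  field
    p              : Fin (suc n) → Vec (V G) 3 → V G
    isPolymorphism : ∀ i → IsPolymorphism G 3 (p i)
    p-first        : ∀ x y z → p zero (x ∷ y ∷ z ∷ []) ≡ x
    p-link         : ∀ (i : Fin n) x y →
                     p (inject₁ i) (x ∷ x ∷ y ∷ []) ≡ p (suc i) (x ∷ y ∷ y ∷ [])
    p-last         : ∀ x y z → p (fromℕ n) (x ∷ y ∷ z ∷ []) ≡ z

{-# OPTIONS --safe #-}

-- Forwards, the chain p₀, …, pₙ is lengthened by one polymorphism at each end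
-- and extended to G ^⊥⊤ by returning ⊤ on triples that contain ⊤, and ⊥ on the
-- other triples that contain ⊥.  The two extreme members (extensions of the
-- first and third projections) must deviate from this: the first one returns x
-- at (x, ⊥, ⊥) and (x, ⊤, ⊤), the last one z at (⊥, ⊥, z) and (⊤, ⊤, z).
--
-- Backwards, let q₀, …, qₙ₊₂ be given.  Each qᵢ preserves G, since a vertex
-- belongs to G iff it lies between two vertices ⊥⟶v⟶⊤ of G ^⊥⊤.  If x, y, z
-- are vertices of G then q₁(u, ⊥, ⊥) = u ⟶ q₁(x, y, z) for u ⟶ x, and
-- q₁(x, y, z) ⟶ q₁(u, ⊤, ⊤) = u for x ⟶ u, so q₁(x, y, z) = x when G is
-- nondismantlable.  Likewise qₙ₊₁(x, y, z) = z, so q₁, …, qₙ₊₁ restrict to a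
-- chain for G.
module Submission where

open import Defs
open import Data.Fin using (Fin; zero; suc; inject₁; fromℕ)
open import Data.Maybe as Maybe using (Maybe; just; nothing)
open import Data.Maybe.Effectful using (applicative)
open import Data.Nat using (ℕ; zero; suc; _+_; _≤_)
open import Data.Nat.Properties using (+-comm)
open import Data.Product using (_×_; ∃; _,_; proj₁; proj₂)
open import Data.Vec using (Vec; []; _∷_; head; last; map; reverse)
open import Data.Vec.Effectful using (module TraversableA)
open import Data.Vec.Relation.Binary.Pointwise.Inductive using (Pointwise; []; _∷_; map⁺)
open import Function using (_∘_)
open import Level using (0ℓ)
open import Relation.Binary using (Rel)
open import Relation.Binary.PropositionalEquality
  using (_≡_; refl; sym; trans; cong; subst; subst₂)
import Relation.Binary.Construct.Add.Infimum.Strict as AddInfimum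
import Relation.Binary.Construct.Add.Supremum.Strict as AddSupremum
open AddInfimum using (⊥₋<[_]; [_])
open AddSupremum using ([_]<⊤⁺; [_])
open TraversableA (applicative {0ℓ}) using (sequenceA)

open Digraph using (V)

-- Extending operations by an added point.

Op₃ : Set → Set
Op₃ A = Vec A 3 → A

Linked : {A : Set} → Op₃ A → Op₃ A → Set
Linked f g = ∀ x y → f (x ∷ x ∷ y ∷ []) ≡ g (x ∷ y ∷ y ∷ [])

-- `sequenceA` collapses all tuples that contain the added point to one; ⊥ and ⊤ are both `nothing`,
-- so one definition serves both.
extend : ∀ {A k} → (Vec A k → A) → Vec (Maybe A) k → Maybe A
extend f xs = Maybe.map f (sequenceA xs)

module _ {A : Set} {_<_ : Rel A 0ℓ} where

  open AddInfimum using (_<₋_)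
  open AddSupremum using (_<⁺_)

  -- No edge enters ⊥, so the target tuple is free of ⊥ and survives as `just`. Thus collapsing is a
  -- homomorphism from the power of a ⊥-extension to the ⊥-extension of the power.
  sequenceA-<₋ : ∀ {k} {as bs : Vec (Maybe A) k} → Pointwise (_<₋_ _<_) as bs →
                 _<₋_ (Pointwise _<_) (sequenceA as) (sequenceA bs)
  sequenceA-<₋ []       = [ [] ]
  sequenceA-<₋ {as = _ ∷ as} {_ ∷ bs} (e ∷ es)
    with sequenceA as | sequenceA bs | sequenceA-<₋ es
  sequenceA-<₋ (⊥₋<[ _ ] ∷ _) | _ | _ | ⊥₋<[ _ ] = ⊥₋<[ _ ]
  sequenceA-<₋ (⊥₋<[ _ ] ∷ _) | _ | _ | [ _ ]    = ⊥₋<[ _ ]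
  sequenceA-<₋ ([ _ ]    ∷ _) | _ | _ | ⊥₋<[ _ ] = ⊥₋<[ _ ]
  sequenceA-<₋ ([ e ]    ∷ _) | _ | _ | [ es ]   = [ e ∷ es ]

  sequenceA-<⁺ : ∀ {k} {as bs : Vec (Maybe A) k} → Pointwise (_<⁺_ _<_) as bs →
                 _<⁺_ (Pointwise _<_) (sequenceA as) (sequenceA bs)
  sequenceA-<⁺ []       = [ [] ]
  sequenceA-<⁺ {as = _ ∷ as} {_ ∷ bs} (e ∷ es)
    with sequenceA as | sequenceA bs | sequenceA-<⁺ es
  sequenceA-<⁺ ([ _ ]<⊤⁺ ∷ _) | _ | _ | [ _ ]<⊤⁺ = [ _ ]<⊤⁺
  sequenceA-<⁺ ([ _ ]<⊤⁺ ∷ _) | _ | _ | [ _ ]    = [ _ ]<⊤⁺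
  sequenceA-<⁺ ([ _ ]    ∷ _) | _ | _ | [ _ ]<⊤⁺ = [ _ ]<⊤⁺
  sequenceA-<⁺ ([ e ]    ∷ _) | _ | _ | [ es ]   = [ e ∷ es ]

extend-^⊥ : ∀ (G : Digraph) {k f} → IsPolymorphism G k f → IsPolymorphism (G ^⊥) k (extend f)
extend-^⊥ G f-poly {as} {bs} es with sequenceA as | sequenceA bs | sequenceA-<₋ es
... | _ | _ | ⊥₋<[ _ ] = ⊥₋<[ _ ]
... | _ | _ | [ es′ ]  = [ f-poly es′ ]

extend-^⊤ : ∀ (G : Digraph) {k f} → IsPolymorphism G k f → IsPolymorphism (G ^⊤) k (extend f)
extend-^⊤ G f-poly {as} {bs} es with sequenceA as | sequenceA bs | sequenceA-<⁺ es
... | _ | _ | [ _ ]<⊤⁺ = [ _ ]<⊤⁺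
... | _ | _ | [ es′ ]  = [ f-poly es′ ]

extendˡ : ∀ {A} → Op₃ A → Op₃ (Maybe A)
extendˡ f (x ∷ nothing ∷ nothing ∷ []) = x
extendˡ f xs                           = extend f xs

-- Targets of edges are free of ⊥, so `extendˡ f` can deviate from `extend f` only at a source
-- `(a, ⊥, ⊥)`; the first hypothesis covers that case.
extendˡ-^⊥ : ∀ G {f} → let open Digraph G using (_⟶_) in
             (∀ {a a′} b c → a ⟶ a′ → a ⟶ f (a′ ∷ b ∷ c ∷ [])) →
             IsPolymorphism G 3 f → IsPolymorphism (G ^⊥) 3 (extendˡ f)
extendˡ-^⊥ G f-head f-poly (⊥₋<[ _ ] ∷ ⊥₋<[ _ ] ∷ ⊥₋<[ _ ] ∷ []) = ⊥₋<[ _ ]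
extendˡ-^⊥ G f-head f-poly ([ e ] ∷ ⊥₋<[ b ] ∷ ⊥₋<[ c ] ∷ [])    = [ f-head b c e ]
extendˡ-^⊥ G f-head f-poly es@(_ ∷ ⊥₋<[ _ ] ∷ [ _ ] ∷ [])        = extend-^⊥ G f-poly es
extendˡ-^⊥ G f-head f-poly es@(_ ∷ [ _ ] ∷ ⊥₋<[ _ ] ∷ [])        = extend-^⊥ G f-poly es
extendˡ-^⊥ G f-head f-poly es@(_ ∷ [ _ ] ∷ [ _ ] ∷ [])           = extend-^⊥ G f-poly es

extendˡ-^⊤ : ∀ G {f} → let open Digraph G using (_⟶_) in
             (∀ {a a′} b c → a ⟶ a′ → f (a ∷ b ∷ c ∷ []) ⟶ a′) →
             IsPolymorphism G 3 f → IsPolymorphism (G ^⊤) 3 (extendˡ f)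
extendˡ-^⊤ G f-head f-poly ([ _ ]<⊤⁺ ∷ [ _ ]<⊤⁺ ∷ [ _ ]<⊤⁺ ∷ []) = [ _ ]<⊤⁺
extendˡ-^⊤ G f-head f-poly ([ e ] ∷ [ b ]<⊤⁺ ∷ [ c ]<⊤⁺ ∷ [])    = [ f-head b c e ]
extendˡ-^⊤ G f-head f-poly es@(_ ∷ [ _ ]<⊤⁺ ∷ [ _ ] ∷ [])        = extend-^⊤ G f-poly es
extendˡ-^⊤ G f-head f-poly es@(_ ∷ [ _ ] ∷ [ _ ]<⊤⁺ ∷ [])        = extend-^⊤ G f-poly es
extendˡ-^⊤ G f-head f-poly es@(_ ∷ [ _ ] ∷ [ _ ] ∷ [])           = extend-^⊤ G f-poly es

-- The value is `a` or ⊥, and the target of an edge is never ⊥, hence is an out-neighbour of ⊥. This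
-- supplies the first hypothesis of `extendˡ-^⊤` over `G ^⊥`.
extendˡ-head-below : ∀ G → let open Digraph (G ^⊥) using (_⟶_) in
                     ∀ {a a′} b c → a ⟶ a′ → extendˡ head (a ∷ b ∷ c ∷ []) ⟶ a′
extendˡ-head-below G nothing  nothing  e        = e
extendˡ-head-below G nothing  (just _) ⊥₋<[ _ ] = ⊥₋<[ _ ]
extendˡ-head-below G nothing  (just _) [ _ ]    = ⊥₋<[ _ ]
extendˡ-head-below G (just _) nothing  ⊥₋<[ _ ] = ⊥₋<[ _ ]
extendˡ-head-below G (just _) nothing  [ _ ]    = ⊥₋<[ _ ]
extendˡ-head-below G (just _) (just _) ⊥₋<[ _ ] = ⊥₋<[ _ ]
extendˡ-head-below G (just _) (just _) [ e ]    = [ e ]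

-- The linking identities under extension.

module _ {A : Set} {f g : Op₃ A} where

  -- The triples `(x, x, y)` and `(x, y, y)` have the same entries, so both sides reach the added
  -- point together.
  linked-extend : Linked f g → Linked (extend f) (extend g)
  linked-extend f~g nothing  _        = refl
  linked-extend f~g (just _) nothing  = refl
  linked-extend f~g (just x) (just y) = cong just (f~g x y)

  -- A triple `(x, x, y)` is exceptional for `extendˡ` only if `x` is the added point, and the value
  -- there is that same point.
  linked-extendˡ : Linked f g → Linked (extendˡ f) (extend g)
  linked-extendˡ f~g nothing  nothing  = refl
  linked-extendˡ f~g nothing  (just _) = refl
  linked-extendˡ f~g (just _) nothing  = refl
  linked-extendˡ f~g (just x) (just y) = cong just (f~g x y)

  linked-extendʳ : Linked f (g ∘ reverse) → Linked (extend f) (extendˡ g ∘ reverse)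
  linked-extendʳ f~g nothing  nothing  = refl
  linked-extendʳ f~g nothing  (just _) = refl
  linked-extendʳ f~g (just _) nothing  = refl
  linked-extendʳ f~g (just x) (just y) = cong just (f~g x y)

  linked-extendˡʳ : Linked f (g ∘ reverse) → Linked (extendˡ f) (extendˡ g ∘ reverse)
  linked-extendˡʳ f~g nothing  nothing  = refl
  linked-extendˡʳ f~g nothing  (just _) = refl
  linked-extendˡʳ f~g (just _) nothing  = refl
  linked-extendˡʳ f~g (just x) (just y) = cong just (f~g x y)

-- Here the exceptional values matter: if `y` is the added point, `(x, y, y)` must go to `x`,
-- whereas `extend` would return `y`.
linked-head-extendˡ : ∀ {A} {f : Op₃ A} → Linked head f → Linked head (extendˡ f)
linked-head-extendˡ head~f nothing  nothing  = refl
linked-head-extendˡ head~f (just _) nothing  = refl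
linked-head-extendˡ head~f nothing  (just _) = refl
linked-head-extendˡ head~f (just x) (just y) = cong just (head~f x y)

-- The chain on `G ^⊥⊤`.

extend² : ∀ {A} → Op₃ A → Op₃ (Maybe (Maybe A))
extend² f = extend (extend f)

first² last² : ∀ {A} → Op₃ (Maybe (Maybe A))
first² = extendˡ (extendˡ head)
last²  = first² ∘ reverse

linked-head-first² : ∀ {A} → Linked head (first² {A})
linked-head-first² = linked-head-extendˡ (linked-head-extendˡ λ _ _ → refl)

reverse-isPolymorphism : ∀ G {f} → IsPolymorphism G 3 f → IsPolymorphism G 3 (f ∘ reverse)
reverse-isPolymorphism G f-poly (a ∷ b ∷ c ∷ []) = f-poly (c ∷ b ∷ a ∷ [])

first²-isPolymorphism : ∀ G → IsPolymorphism (G ^⊥⊤) 3 first²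
first²-isPolymorphism G =
  extendˡ-^⊤ (G ^⊥) (extendˡ-head-below G)
    (extendˡ-^⊥ G (λ _ _ e → e) λ { (e ∷ _) → e })

-- The members of index at least 2 of the chain on G ^⊥⊤; the one coming from
-- the final p is replaced by last².
upper : ∀ {A} n → (Fin (suc n) → Op₃ A) → Fin (suc (suc n)) → Op₃ (Maybe (Maybe A))
upper zero    p zero       = last²
upper zero    p (suc zero) = last
upper (suc n) p zero       = extend² (p zero)
upper (suc n) p (suc i)    = upper n (p ∘ suc) i

upper-isPolymorphism : ∀ G n p → (∀ i → IsPolymorphism G 3 (p i)) →
                       ∀ i → IsPolymorphism (G ^⊥⊤) 3 (upper n p i)
upper-isPolymorphism G zero    p p-poly zero       =
  reverse-isPolymorphism (G ^⊥⊤) (first²-isPolymorphism G)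
upper-isPolymorphism G zero    p p-poly (suc zero) (_ ∷ _ ∷ e ∷ []) = e
upper-isPolymorphism G (suc n) p p-poly zero       = extend-^⊤ (G ^⊥) (extend-^⊥ G (p-poly zero))
upper-isPolymorphism G (suc n) p p-poly (suc i)    =
  upper-isPolymorphism G n (p ∘ suc) (p-poly ∘ suc) i

module _ {A : Set} where

  LastIsLast : ∀ n → (Fin (suc n) → Op₃ A) → Set
  LastIsLast n p = ∀ x y z → p (fromℕ n) (x ∷ y ∷ z ∷ []) ≡ z

  first²-linked-upper : ∀ n p → LastIsLast n p → Linked head (p zero) →
                        Linked first² (upper n p zero)
  -- `p zero` is the third projection here, so its link to `head` makes all elements of `A` equal,
  -- and `first²` links directly to `last²`.
  first²-linked-upper zero    p p-last head~p =
    linked-extendˡʳ (linked-extendˡʳ λ x y → trans (head~p x y) (p-last x y y))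
  first²-linked-upper (suc n) p p-last head~p = linked-extendˡ (linked-extendˡ head~p)

  -- If only the final member remains, `p-last` makes it the third projection, so a link to it
  -- carries over to `last²`.
  extend²-linked-upper : ∀ n p {f} → LastIsLast n p → Linked f (p zero) →
                         Linked (extend² f) (upper n p zero)
  extend²-linked-upper zero    p p-last f~p =
    linked-extendʳ (linked-extendʳ λ x y → trans (f~p x y) (p-last x y y))
  extend²-linked-upper (suc n) p p-last f~p = linked-extend (linked-extend f~p)

  upper-link : ∀ n p → LastIsLast n p → (∀ i → Linked (p (inject₁ i)) (p (suc i))) →
               ∀ i → Linked (upper n p (inject₁ i)) (upper n p (suc i))
  -- The mirror image of the link between `head` and `first²`.
  upper-link zero    p p-last p-link zero x y = sym (linked-head-first² y x)
  upper-link (suc n) p p-last p-link zero    =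
    extend²-linked-upper n (p ∘ suc) p-last (p-link zero)
  upper-link (suc n) p p-last p-link (suc i) = upper-link n (p ∘ suc) p-last (p-link ∘ suc) i

  upper-last : ∀ n (p : Fin (suc n) → Op₃ A) x y z → upper n p (fromℕ (suc n)) (x ∷ y ∷ z ∷ []) ≡ z
  upper-last zero    p x y z = refl
  upper-last (suc n) p       = upper-last n (p ∘ suc)

congruencePermutable-^⊥⊤ : ∀ G n → CongruencePermutable (suc n) G →
                           CongruencePermutable (suc (suc (suc n))) (G ^⊥⊤)
congruencePermutable-^⊥⊤ G n cp = record
  { p              = q
  ; isPolymorphism = q-isPolymorphism
  ; p-first        = λ _ _ _ → refl
  ; p-link         = q-link
  ; p-last         = upper-last n (p ∘ suc)
  }
  where
  open CongruencePermutable cp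

  -- `first²` takes the place of `p zero`, hence the shift to `p ∘ suc` in `upper`.
  q : Fin (suc (suc (suc (suc n)))) → Op₃ (V (G ^⊥⊤))
  q zero          = head
  q (suc zero)    = first²
  q (suc (suc i)) = upper n (p ∘ suc) i

  q-isPolymorphism : ∀ i → IsPolymorphism (G ^⊥⊤) 3 (q i)
  q-isPolymorphism zero          (e ∷ _) = e
  q-isPolymorphism (suc zero)    = first²-isPolymorphism G
  q-isPolymorphism (suc (suc i)) = upper-isPolymorphism G n (p ∘ suc) (isPolymorphism ∘ suc) i

  q-link : ∀ i → Linked (q (inject₁ i)) (q (suc i))
  q-link zero          = linked-head-first²
  q-link (suc zero)    = first²-linked-upper n (p ∘ suc) p-last
    λ x y → trans (sym (p-first x x y)) (p-link zero x y)
  q-link (suc (suc i)) = upper-link n (p ∘ suc) p-last (p-link ∘ suc) i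

-- Restricting a chain on `G ^⊥⊤` to G.

module _ (G : Digraph) where

  open Digraph G using (_⟶_)
  open Digraph (G ^⊥⊤) using () renaming (_⟶_ to _⇒_)

  embed : V G → V (G ^⊥⊤)
  embed x = just (just x)

  pattern ⊥′ = just nothing
  pattern ⊤′ = nothing

  ⊥⇒embed : ∀ x → ⊥′ ⇒ embed x
  ⊥⇒embed x = [ ⊥₋<[ x ] ]

  embed⇒⊤ : ∀ x → embed x ⇒ ⊤′
  embed⇒⊤ x = [ just x ]<⊤⁺

  embed-edge : ∀ {x y} → x ⟶ y → embed x ⇒ embed y
  embed-edge e = [ [ e ] ]

  embed-edge⁻¹ : ∀ {x y} → embed x ⇒ embed y → x ⟶ y
  embed-edge⁻¹ [ [ e ] ] = e

  embed-injective : ∀ {x y} → embed x ≡ embed y → x ≡ y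
  embed-injective refl = refl

  -- No edge enters ⊥ and none leaves ⊤.
  between : ∀ {u v w} → u ⇒ v → v ⇒ w → ∃ λ x → v ≡ embed x
  between [ ⊥₋<[ x ] ] _ = x , refl
  between [ [_] {l = x} _ ] _ = x , refl

  module _ {k f} (f-poly : IsPolymorphism (G ^⊥⊤) k f) where

    preserves : ∀ xs → ∃ λ x → f (map embed xs) ≡ embed x
    -- The witnesses are the constant tuples ⊥ and ⊤.
    preserves xs = between (f-poly (below xs)) (f-poly (above xs))
      where
      below : ∀ {n} (xs : Vec (V G) n) → Pointwise _⇒_ (map (λ _ → ⊥′) xs) (map embed xs)
      below []       = []
      below (x ∷ xs) = ⊥⇒embed x ∷ below xs

      above : ∀ {n} (xs : Vec (V G) n) → Pointwise _⇒_ (map embed xs) (map (λ _ → ⊤′) xs)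
      above []       = []
      above (x ∷ xs) = embed⇒⊤ x ∷ above xs

    restrict : Vec (V G) k → V G
    restrict xs = proj₁ (preserves xs)

    embed-restrict : ∀ xs → f (map embed xs) ≡ embed (restrict xs)
    embed-restrict xs = proj₂ (preserves xs)

    restrict-isPolymorphism : IsPolymorphism G k restrict
    restrict-isPolymorphism {as} {bs} es = embed-edge⁻¹
      (subst₂ _⇒_ (embed-restrict as) (embed-restrict bs) (f-poly (map⁺ embed-edge es)))

  nondismantlable⇒≡ : Nondismantlable G → ∀ {x w} →
                      (∀ {u} → embed u ⇒ embed x → embed u ⇒ embed w) →
                      (∀ {u} → embed x ⇒ embed u → embed w ⇒ embed u) → x ≡ w
  nondismantlable⇒≡ nd {x} {w} in⊆ out⊆ =
    nd x w (embed-edge⁻¹ ∘ out⊆ ∘ embed-edge) (embed-edge⁻¹ ∘ in⊆ ∘ embed-edge)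

  restrict-first : Nondismantlable G → ∀ {f} (f-poly : IsPolymorphism (G ^⊥⊤) 3 f) →
                   Linked head f → ∀ x y z → restrict f-poly (x ∷ y ∷ z ∷ []) ≡ x
  restrict-first nd f-poly head~f x y z = sym (nondismantlable⇒≡ nd
    -- The link at `(u, u, ⊥)` gives `f (u, ⊥, ⊥) ≡ u`; the next line does the same with ⊤.
    (λ e → subst₂ _⇒_ (sym (head~f _ ⊥′)) eq (f-poly (e ∷ ⊥⇒embed y ∷ ⊥⇒embed z ∷ [])))
    (λ e → subst₂ _⇒_ eq (sym (head~f _ ⊤′)) (f-poly (e ∷ embed⇒⊤ y ∷ embed⇒⊤ z ∷ []))))
    where eq = embed-restrict f-poly (x ∷ y ∷ z ∷ [])

  restrict-last : Nondismantlable G → ∀ {f} (f-poly : IsPolymorphism (G ^⊥⊤) 3 f) →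
                  Linked f last → ∀ x y z → restrict f-poly (x ∷ y ∷ z ∷ []) ≡ z
  restrict-last nd f-poly f~last x y z = sym (nondismantlable⇒≡ nd
    (λ e → subst₂ _⇒_ (f~last ⊥′ _) eq (f-poly (⊥⇒embed x ∷ ⊥⇒embed y ∷ e ∷ [])))
    (λ e → subst₂ _⇒_ eq (f~last ⊤′ _) (f-poly (embed⇒⊤ x ∷ embed⇒⊤ y ∷ e ∷ []))))
    where eq = embed-restrict f-poly (x ∷ y ∷ z ∷ [])

  congruencePermutable-^⊥⊤⁻¹ : ∀ n → Nondismantlable G →
                               CongruencePermutable (suc (suc n)) (G ^⊥⊤) →
                               CongruencePermutable n G
  congruencePermutable-^⊥⊤⁻¹ n nd cp = record
    { p              = λ i → restrict (q-poly i)
    ; isPolymorphism = λ i → restrict-isPolymorphism (q-poly i)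
    ; p-first        = restrict-first nd (q-poly zero)
        λ x y → trans (sym (p-first x x y)) (p-link zero x y)
    ; p-link         = λ i x y → embed-injective (trans
        (sym (embed-restrict (q-poly (inject₁ i)) (x ∷ x ∷ y ∷ [])))
        (trans (p-link (suc (inject₁ i)) (embed x) (embed y))
          (embed-restrict (q-poly (suc i)) (x ∷ y ∷ y ∷ []))))
    ; p-last         = restrict-last nd (q-poly (fromℕ n))
        λ x y → trans (p-link (fromℕ (suc n)) x y) (p-last x y y)
    }
    where
    open CongruencePermutable cp

    -- `suc` skips the first member of the given chain and `inject₁` the final one.
    q-poly : ∀ i → IsPolymorphism (G ^⊥⊤) 3 (p (suc (inject₁ i)))
    q-poly i = isPolymorphism (suc (inject₁ i))

theorem5p3 : (G : Digraph) (n : ℕ) → 1 ≤ n →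
    (CongruencePermutable n G → CongruencePermutable (n + 2) (G ^⊥⊤))
    × (Nondismantlable G → CongruencePermutable (n + 2) (G ^⊥⊤) → CongruencePermutable n G)
-- With `2 + n` the index types compute; `suc m` lets the forward chain split off its first member.
theorem5p3 G n@(suc m) _ rewrite +-comm n 2 =
  congruencePermutable-^⊥⊤ G m , congruencePermutable-^⊥⊤⁻¹ G n
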